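{- The system CF is complete for affine retractions: for all simple types $\rho$ and $\tau$, if $\rho\trianglelefteq^1\tau$ holds (i.e. $\rho$ is a retract of $\tau$ via an affine coder and an affine decoder), then the statement $\rho\trianglelefteq^1\tau$ is derivable in the system CF.
   Context: Simple types are built from type variables (atoms) $a,b,c,\dots$ (many distinct atoms) with $\to$. Terms are simply typed $\lambda$-terms in Church style. Retraction: $\rho\trianglelefteq\tau$ means that there are a type environment $E$ and terms $C$ (the coder), $D$ (the decoder) with $E,(x:\rho)\vdash C:\tau$, $E\vdash D:\tau\to\rho$, $x\notin FV(D)$, and $DC=_{\beta\eta}x$. The types of the free variables declared in $E$ are arbitrary. A $\lambda$-term is affine (a BCK-term) if each variable occurs in it at most once. $\rho\trianglelefteq^1\tau$ means that $\rho\trianglelefteq\tau$ holds with an affine coder $C$ and an affine decoder $D$. Isomorphism convention: $\sim$ is the least equivalence relation on simple types such that (1) $\tau\sim\tau'$ and $\sigma\sim\sigma'$ imply $(\tau\to\sigma)\sim(\tau'\to\sigma')$, and (2) $(\tau\to\sigma\to\rho)\sim(\sigma\to\tau\to\rho)$. Types related by $\sim$ are identified, in particular in derivations. For a finite multiset of types $\Sigma=\{\tau_1,\dots,\tau_k\}$, $\Sigma\to\rho$ denotes (any representative of the $\sim$-class of) $\tau_1\to\cdots\to\tau_k\to\rho$ (just $\rho$ if $\Sigma$ is empty). System CF derives statements of the form $\rho\trianglelefteq^1\tau$ (types modulo $\sim$) from: (Axiom) $a\trianglelefteq^1 a$, for each atom $a$. (H) from $\sigma\trianglelefteq^1\sigma'$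 and $\tau\trianglelefteq^1\tau'$ infer $\sigma\to\tau\trianglelefteq^1\sigma'\to\tau'$. (N) from $\rho\trianglelefteq^1\tau$ infer $\rho\trianglelefteq^1\Sigma\to\tau$. (D) from $\Delta_1\to a\trianglelefteq^1\sigma_1,\ \dots,\ \Delta_n\to a\trianglelefteq^1\sigma_n$ infer $\Delta_1\cup\dots\cup\Delta_n\to a\ \trianglelefteq^1\ \{\Sigma_1\to\sigma_1\to a,\dots,\Sigma_n\to\sigma_n\to a\}\to a$. Here $\Sigma,\Sigma_i,\Delta_i$ are arbitrary finite multisets of types, $\cup$ is multiset union, and $a$ is an atom. -}

module Defs where

open import Data.Fin using (Fin; zero; suc; _≟_)
open import Data.List using (List; []; _∷_; foldr; concat; tabulate; length)
open import Data.List.Membership.Propositional using (_∈_)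
open import Data.List.Relation.Binary.Subset.Propositional using (_⊆_)
open import Data.List.Relation.Binary.Subset.Propositional.Properties using (∷⁺ʳ)
open import Data.List.Relation.Unary.Any using (here; there; index)
open import Data.Bool using (if_then_else_)
open import Data.Nat using (ℕ; _+_; _≤_)
open import Data.Product using (Σ-syntax; _×_)
open import Data.Unit using (⊤)
open import Relation.Binary.Construct.Closure.Equivalence using (EqClosure)
open import Relation.Binary.PropositionalEquality using (refl)
open import Relation.Nullary using (does)

infixr 7 _⇒_ _⇛_
infix  4 _∼_ _⊢_ _⟶_ _=βη_ _⊴_ _⊴¹_ CF⊢_⊴¹_
infixl 8 _·_
infix  6 ƛ_

data Ty : Set where
  atom : ℕ → Ty
  _⇒_  : Ty → Ty → Ty

-- Multisets of types are represented by lists; reorderings of Σ give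
-- ∼-related types Σ ⇛ ρ.
_⇛_ : List Ty → Ty → Ty
Σ ⇛ ρ = foldr _⇒_ ρ Σ

data _∼_ : Ty → Ty → Set where
  ∼-refl  : ∀ {τ} → τ ∼ τ
  ∼-sym   : ∀ {τ σ} → τ ∼ σ → σ ∼ τ
  ∼-trans : ∀ {τ σ ρ} → τ ∼ σ → σ ∼ ρ → τ ∼ ρ
  ∼-cong  : ∀ {τ τ′ σ σ′} → τ ∼ τ′ → σ ∼ σ′ → (τ ⇒ σ) ∼ (τ′ ⇒ σ′)
  ∼-swap  : ∀ {τ σ ρ} → (τ ⇒ σ ⇒ ρ) ∼ (σ ⇒ τ ⇒ ρ)

-- Church-style terms, intrinsically typed with de Bruijn variables, so that
-- α-equivalent terms are equal.
Ctx : Set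
Ctx = List Ty

data _⊢_ (Γ : Ctx) : Ty → Set where
  var : ∀ {τ} → τ ∈ Γ → Γ ⊢ τ
  ƛ_  : ∀ {σ τ} → (σ ∷ Γ) ⊢ τ → Γ ⊢ σ ⇒ τ
  _·_ : ∀ {σ τ} → Γ ⊢ σ ⇒ τ → Γ ⊢ σ → Γ ⊢ τ

rename : ∀ {Γ Δ τ} → Γ ⊆ Δ → Γ ⊢ τ → Δ ⊢ τ
rename r (var x) = var (r x)
rename r (ƛ t)   = ƛ rename (∷⁺ʳ _ r) t
rename r (t · u) = rename r t · rename r u

weaken : ∀ {Γ σ τ} → Γ ⊢ τ → (σ ∷ Γ) ⊢ τ
weaken = rename there

Subst : Ctx → Ctx → Set
Subst Γ Δ = ∀ {τ} → τ ∈ Γ → Δ ⊢ τ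

lift : ∀ {Γ Δ σ} → Subst Γ Δ → Subst (σ ∷ Γ) (σ ∷ Δ)
lift s (here refl) = var (here refl)
lift s (there x)   = weaken (s x)

subst : ∀ {Γ Δ τ} → Subst Γ Δ → Γ ⊢ τ → Δ ⊢ τ
subst s (var x) = s x
subst s (ƛ t)   = ƛ subst (lift s) t
subst s (t · u) = subst s t · subst s u

single : ∀ {Γ σ} → Γ ⊢ σ → Subst (σ ∷ Γ) Γ
single u (here refl) = u
single u (there x)   = var x

_[_] : ∀ {Γ σ τ} → (σ ∷ Γ) ⊢ τ → Γ ⊢ σ → Γ ⊢ τ
t [ u ] = subst (single u) t

data _⟶_ {Γ : Ctx} : ∀ {τ} → Γ ⊢ τ → Γ ⊢ τ → Set where
  β  : ∀ {σ τ} {t : (σ ∷ Γ) ⊢ τ} {u : Γ ⊢ σ} → (ƛ t) · u ⟶ t [ u ]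
  η  : ∀ {σ τ} {t : Γ ⊢ σ ⇒ τ} → ƛ (weaken t · var (here refl)) ⟶ t
  ξ  : ∀ {σ τ} {t t′ : (σ ∷ Γ) ⊢ τ} → t ⟶ t′ → ƛ t ⟶ ƛ t′
  ·ˡ : ∀ {σ τ} {t t′ : Γ ⊢ σ ⇒ τ} {u : Γ ⊢ σ} → t ⟶ t′ → t · u ⟶ t′ · u
  ·ʳ : ∀ {σ τ} {t : Γ ⊢ σ ⇒ τ} {u u′ : Γ ⊢ σ} → u ⟶ u′ → t · u ⟶ t · u′

_=βη_ : ∀ {Γ τ} → Γ ⊢ τ → Γ ⊢ τ → Set
_=βη_ = EqClosure _⟶_

occurrences : ∀ {Γ τ} → Fin (length Γ) → Γ ⊢ τ → ℕ
occurrences i (var x) = if does (i ≟ index x) then 1 else 0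
occurrences i (ƛ t)   = occurrences (suc i) t
occurrences i (t · u) = occurrences i t + occurrences i u

AffineBound : ∀ {Γ τ} → Γ ⊢ τ → Set
AffineBound (var x) = ⊤
AffineBound (ƛ t)   = occurrences zero t ≤ 1 × AffineBound t
AffineBound (t · u) = AffineBound t × AffineBound u

-- The condition covers the free variables as well as the bound ones.
Affine : ∀ {Γ τ} → Γ ⊢ τ → Set
Affine t = (∀ i → occurrences i t ≤ 1) × AffineBound t

record _⊴_ (ρ τ : Ty) : Set where
  field
    env     : Ctx
    coder   : (ρ ∷ env) ⊢ τ
    -- x ∉ FV(D) holds because D is typed in env alone.
    decoder : env ⊢ τ ⇒ ρ
    retract : weaken decoder · coder =βη var (here refl)

-- The coder and the decoder are each affine; they may share variables of env.
_⊴¹_ : Ty → Ty → Set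
ρ ⊴¹ τ = Σ[ r ∈ ρ ⊴ τ ] Affine (_⊴_.coder r) × Affine (_⊴_.decoder r)

-- The rule ∼-conv expresses that derivations are about types modulo ∼.
data CF⊢_⊴¹_ : Ty → Ty → Set where
  Axiom  : ∀ a → CF⊢ atom a ⊴¹ atom a
  H      : ∀ {σ σ′ τ τ′} →
           CF⊢ σ ⊴¹ σ′ → CF⊢ τ ⊴¹ τ′ → CF⊢ σ ⇒ τ ⊴¹ σ′ ⇒ τ′
  N      : ∀ {ρ τ} (Σ : List Ty) → CF⊢ ρ ⊴¹ τ → CF⊢ ρ ⊴¹ Σ ⇛ τ
  D      : ∀ {a n} (Δ Σ : Fin n → List Ty) (σ : Fin n → Ty) →
           (∀ i → CF⊢ Δ i ⇛ atom a ⊴¹ σ i) →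
           CF⊢ concat (tabulate Δ) ⇛ atom a
             ⊴¹ tabulate (λ i → Σ i ⇛ σ i ⇒ atom a) ⇛ atom a
  ∼-conv : ∀ {ρ ρ′ τ τ′} →
           ρ ∼ ρ′ → τ ∼ τ′ → CF⊢ ρ ⊴¹ τ → CF⊢ ρ′ ⊴¹ τ′

{-# OPTIONS --safe #-}
module Submission where

-- The proof compares normal forms only through the full type hierarchy over a two-element
-- set: D C = x yields an identity between functions on finite sets.  Variables of the
-- environment are interpreted by 0, so only x and the bound variables remain.
--
-- Let ρ = Δ → a.  By head normalisation D is λ y z. y T⃗, since any other head would give the
-- value 0 where x may be constantly 1; hence τ = Θ → a and the coder is a term C with
-- C[T⃗/y⃗] = x z⃗.  Consider the head of C.
--   * If C = x U⃗, then U_j[T⃗/y⃗] = z_j.  So z_j occurs in the decoded argument T_i of some y_i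
--     in U_j, and ρ_j is a retract of τ_i.  By affinity different j have different i, so
--     rule H applies to these pairs and N discards the remaining τ_i.
--   * If C = y_i U⃗, some U_q : σ contains x.  Let Δ₁ be the types of the variables z⃗ occurring in
--     T_i.  Setting the other variables to 0 makes Δ₁ → a a retract of σ, while setting
--     those of T_i to 0 solves the same problem for the rest of Δ and Θ without τ_i.
--     This contributes one premise to rule D.

open import Defs hiding (single; _[_]; subst)

open import Data.Empty using (⊥-elim)
open import Data.Bool using (if_then_else_)
open import Data.Fin using (Fin; zero; suc; _≟_; combine; finToFun; funToFin)
open import Data.Fin.Patterns using (0F; 1F)
open import Data.Fin.Properties using (funToFin-finToFin; finToFun-funToFin)
open import Data.List using ([]; _∷_; [_]; _++_; map; length; concat; tabulate)
open import Data.List.Properties using (++-assoc; ++-identityʳ; map-++)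
open import Data.List.Relation.Binary.Permutation.Propositional as ↭
  using (_↭_; ↭-trans; ↭-sym; ↭-reflexive)
open import Data.List.Relation.Binary.Permutation.Propositional.Properties
  using (shift; shifts; ++⁺ʳ; map⁺)
open import Data.List.Relation.Binary.Sublist.Propositional
  using ([]; _∷_; _∷ʳ_; minimum) renaming (_⊆_ to Sublist)
open import Data.List.Relation.Binary.Subset.Propositional using (_⊆_)
open import Data.List.Relation.Binary.Subset.Propositional.Properties using (∷⁺ʳ)
open import Data.List.Membership.Propositional using (_∈_)
open import Data.List.Relation.Unary.Any using (here; there; index)
open import Data.List.Relation.Ternary.Interleaving.Propositional
  using ([]; _∷ˡ_; _∷ʳ_; consˡ; consʳ; swap; toPermutation) renaming (Interleaving to Split)
open import Data.List.Relation.Unary.All using (All; []; _∷_; head; tail)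
open import Data.Nat using (ℕ; zero; suc; _+_; _^_; _≤_; _<_; z≤n; s≤s)
open import Data.Nat.ListAction using (sum)
open import Data.Nat.ListAction.Properties using (sum-↭; sum-++)
open import Data.Nat.Properties
  using ( +-suc; +-identityʳ; m≤m+n; m≤n+m; ≤-trans; ≤-refl; n≤1+n; +-monoˡ-≤
        ; m+n≡0⇒m≡0; m+n≡0⇒n≡0; module ≤-Reasoning)
open import Data.Product using (Σ-syntax; ∃-syntax; _×_; _,_; proj₁; proj₂; -,_)
import Data.Vec.Functional as Vector
open import Function using (_∘_; id)
open import Relation.Binary.PropositionalEquality
  using (_≡_; _≢_; refl; sym; trans; subst; cong; cong₂; module ≡-Reasoning)
open import Relation.Binary.Construct.Closure.ReflexiveTransitive using (ε; _◅_)
open import Relation.Binary.Construct.Closure.Symmetric using (fwd; bwd)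
open import Relation.Nullary using (yes; no; does)

private variable
  a b : ℕ
  ρ σ τ μ : Ty
  A B C AB BC X Γ Γ₁ Γ₂ Δ Δ₁ Δ₂ Θ Θ₁ Θ₂ : Ctx

-- The full finite model

-- Coding function spaces by Fin (m ^ n) makes functions that agree pointwise
-- propositionally equal.

card : Ty → ℕ
card (atom _) = 2
card (σ ⇒ τ)  = card τ ^ card σ

record Val (τ : Ty) : Set where
  constructor ⟨_⟩
  field code : Fin (card τ)
open Val

funToFin-cong : ∀ {m n} {f g : Fin m → Fin n} → (∀ i → f i ≡ g i) → funToFin f ≡ funToFin g
funToFin-cong {zero}  eq = refl
funToFin-cong {suc m} eq = cong₂ combine (eq zero) (funToFin-cong (eq ∘ suc))

infixl 8 _∙_ _∙*_

-- Sealed, so that application and abstraction enter below only through `Λ-β` and `∙-ext`.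
abstract
  _∙_ : Val (σ ⇒ τ) → Val σ → Val τ
  f ∙ v = ⟨ finToFun (code f) (code v) ⟩

  Λ : (Val σ → Val τ) → Val (σ ⇒ τ)
  Λ f = ⟨ funToFin (λ i → code (f ⟨ i ⟩)) ⟩

  Λ-β : (f : Val σ → Val τ) (v : Val σ) → Λ f ∙ v ≡ f v
  Λ-β f v = cong ⟨_⟩ (finToFun-funToFin (λ i → code (f ⟨ i ⟩)) (code v))

  ∙-ext : {f g : Val (σ ⇒ τ)} → (∀ v → f ∙ v ≡ g ∙ v) → f ≡ g
  ∙-ext {σ} {τ} {⟨ i ⟩} {⟨ j ⟩} eq = cong ⟨_⟩ (begin
    i                                            ≡⟨ funToFin-finToFin {card σ} {card τ} i ⟨
    funToFin (finToFun {card τ} {card σ} i)      ≡⟨ funToFin-cong (λ k → cong code (eq ⟨ k ⟩)) ⟩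
    funToFin (finToFun {card τ} {card σ} j)      ≡⟨ funToFin-finToFin {card σ} {card τ} j ⟩
    j                                            ∎)
    where open ≡-Reasoning

-- These values absorb their arguments: a head interpreted by `constant 0F` yields 0 whatever it is
-- applied to, while `x` set to `constant 1F` yields 1. Wrong heads are refuted by this clash.
constant : Fin 2 → Val τ
constant {atom _} i = ⟨ i ⟩
constant {σ ⇒ τ}  i = Λ (λ _ → constant i)

constant-∙ : ∀ i (v : Val σ) → constant {σ ⇒ τ} i ∙ v ≡ constant i
constant-∙ i v = Λ-β (λ _ → constant i) v

constant-≢ : constant {τ} 1F ≢ constant {τ} 0F
constant-≢ {atom _} ()
constant-≢ {σ ⇒ τ}  eq = constant-≢ {τ} (begin
  constant 1F                               ≡⟨ constant-∙ 1F (constant 0F) ⟨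
  constant {σ ⇒ τ} 1F ∙ constant {σ} 0F     ≡⟨ cong (_∙ constant 0F) eq ⟩
  constant {σ ⇒ τ} 0F ∙ constant {σ} 0F     ≡⟨ constant-∙ 0F (constant 0F) ⟩
  constant 0F                               ∎)
  where open ≡-Reasoning

Env : Ctx → Set
Env = All Val

_∙*_ : Val (Θ ⇛ τ) → Env Θ → Val τ
f ∙* []      = f
f ∙* (v ∷ ζ) = f ∙ v ∙* ζ

Λ* : (Env Θ → Val τ) → Val (Θ ⇛ τ)
Λ* {[]}    f = f []
Λ* {σ ∷ Θ} f = Λ (λ v → Λ* (λ ζ → f (v ∷ ζ)))

Λ*-β : (f : Env Θ → Val τ) (ζ : Env Θ) → Λ* f ∙* ζ ≡ f ζ
Λ*-β f []      = refl
Λ*-β f (v ∷ ζ) =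
  trans (cong (_∙* ζ) (Λ-β (λ w → Λ* (λ ζ′ → f (w ∷ ζ′))) v)) (Λ*-β (λ ζ′ → f (v ∷ ζ′)) ζ)

constant-∙* : ∀ i (ζ : Env Θ) → constant {Θ ⇛ τ} i ∙* ζ ≡ constant i
constant-∙* i []      = refl
constant-∙* i (v ∷ ζ) = trans (cong (_∙* ζ) (constant-∙ i v)) (constant-∙* i ζ)

zeros : Env Γ
zeros {[]}    = []
zeros {σ ∷ Γ} = constant 0F ∷ zeros

Env-[] : (γ : Env []) → γ ≡ []
Env-[] [] = refl

-- Splittings of contexts and environments

allˡ : Split Γ [] Γ
allˡ {[]}    = []
allˡ {σ ∷ Γ} = consˡ allˡ

allʳ : Split [] Γ Γ
allʳ {[]}    = []
allʳ {σ ∷ Γ} = consʳ allʳ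

lft : Split A B X → Env X → Env A
lft []        γ       = []
lft (consˡ s) (v ∷ γ) = v ∷ lft s γ
lft (consʳ s) (v ∷ γ) = lft s γ

rgt : Split A B X → Env X → Env B
rgt []        γ       = []
rgt (consˡ s) (v ∷ γ) = rgt s γ
rgt (consʳ s) (v ∷ γ) = v ∷ rgt s γ

join : Split A B X → Env A → Env B → Env X
join []        γ₁       γ₂       = []
join (consˡ s) (v ∷ γ₁) γ₂       = v ∷ join s γ₁ γ₂
join (consʳ s) γ₁       (v ∷ γ₂) = v ∷ join s γ₁ γ₂

lft-join : (s : Split A B X) → ∀ γ₁ γ₂ → lft s (join s γ₁ γ₂) ≡ γ₁
lft-join []        []      γ₂       = refl
lft-join (consˡ s) (v ∷ γ₁) γ₂       = cong (v ∷_) (lft-join s γ₁ γ₂)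
lft-join (consʳ s) γ₁       (v ∷ γ₂) = lft-join s γ₁ γ₂

rgt-join : (s : Split A B X) → ∀ γ₁ γ₂ → rgt s (join s γ₁ γ₂) ≡ γ₂
rgt-join []        γ₁       []      = refl
rgt-join (consˡ s) (v ∷ γ₁) γ₂       = rgt-join s γ₁ γ₂
rgt-join (consʳ s) γ₁       (v ∷ γ₂) = cong (v ∷_) (rgt-join s γ₁ γ₂)

join-lft-rgt : (s : Split A B X) → ∀ γ → join s (lft s γ) (rgt s γ) ≡ γ
join-lft-rgt []        []      = refl
join-lft-rgt (consˡ s) (v ∷ γ) = cong (v ∷_) (join-lft-rgt s γ)
join-lft-rgt (consʳ s) (v ∷ γ) = cong (v ∷_) (join-lft-rgt s γ)

lft-swap : (s : Split A B X) → ∀ γ → lft (swap s) γ ≡ rgt s γ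
lft-swap []        γ       = refl
lft-swap (consˡ s) (v ∷ γ) = lft-swap s γ
lft-swap (consʳ s) (v ∷ γ) = cong (v ∷_) (lft-swap s γ)

rgt-swap : (s : Split A B X) → ∀ γ → rgt (swap s) γ ≡ lft s γ
rgt-swap []        γ       = refl
rgt-swap (consˡ s) (v ∷ γ) = cong (v ∷_) (rgt-swap s γ)
rgt-swap (consʳ s) (v ∷ γ) = rgt-swap s γ

lft-allˡ : (γ : Env Γ) → lft allˡ γ ≡ γ
lft-allˡ []      = refl
lft-allˡ (v ∷ γ) = cong (v ∷_) (lft-allˡ γ)

rgt-allʳ : (γ : Env Γ) → rgt allʳ γ ≡ γ
rgt-allʳ []      = refl
rgt-allʳ (v ∷ γ) = cong (v ∷_) (rgt-allʳ γ)

join-allˡ : (γ : Env Γ) → join allˡ γ [] ≡ γ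
join-allˡ []      = refl
join-allˡ (v ∷ γ) = cong (v ∷_) (join-allˡ γ)

join-allʳ : (γ : Env Γ) → join allʳ [] γ ≡ γ
join-allʳ []      = refl
join-allʳ (v ∷ γ) = cong (v ∷_) (join-allʳ γ)

lft-zeros : (s : Split A B X) → lft s zeros ≡ zeros
lft-zeros []        = refl
lft-zeros (consˡ s) = cong (constant 0F ∷_) (lft-zeros s)
lft-zeros (consʳ s) = lft-zeros s

rgt-zeros : (s : Split A B X) → rgt s zeros ≡ zeros
rgt-zeros []        = refl
rgt-zeros (consˡ s) = rgt-zeros s
rgt-zeros (consʳ s) = cong (constant 0F ∷_) (rgt-zeros s)

-- The equations on projections are returned too, since meanings are functions of environments and
-- must follow each regrouping of the context.
assocʳ : (s : Split A B AB) (t : Split AB C X) →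
         ∃[ BC ] Σ[ q ∈ Split A BC X ] Σ[ p ∈ Split B C BC ]
         (∀ γ → lft q γ ≡ lft s (lft t γ) × lft p (rgt q γ) ≡ rgt s (lft t γ)
                × rgt p (rgt q γ) ≡ rgt t γ)
assocʳ []        []        = -, [] , [] , λ _ → refl , refl , refl
assocʳ s         (consʳ t) = let _ , q , p , eq = assocʳ s t in
  -, consʳ q , consʳ p , λ { (v ∷ γ) → let e , f , g = eq γ in e , f , cong (v ∷_) g }
assocʳ (consˡ s) (consˡ t) = let _ , q , p , eq = assocʳ s t in
  -, consˡ q , p , λ { (v ∷ γ) → let e , f , g = eq γ in cong (v ∷_) e , f , g }
assocʳ (consʳ s) (consˡ t) = let _ , q , p , eq = assocʳ s t in
  -, consʳ q , consˡ p , λ { (v ∷ γ) → let e , f , g = eq γ in e , cong (v ∷_) f , g }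

assocˡ : (q : Split A BC X) (p : Split B C BC) →
         ∃[ AB ] Σ[ s ∈ Split A B AB ] Σ[ t ∈ Split AB C X ]
         (∀ γ → lft s (lft t γ) ≡ lft q γ × rgt s (lft t γ) ≡ lft p (rgt q γ)
                × rgt t γ ≡ rgt p (rgt q γ))
assocˡ []        []        = -, [] , [] , λ _ → refl , refl , refl
assocˡ (consˡ q) p         = let _ , s , t , eq = assocˡ q p in
  -, consˡ s , consˡ t , λ { (v ∷ γ) → let e , f , g = eq γ in cong (v ∷_) e , f , g }
assocˡ (consʳ q) (consˡ p) = let _ , s , t , eq = assocˡ q p in
  -, consʳ s , consˡ t , λ { (v ∷ γ) → let e , f , g = eq γ in e , cong (v ∷_) f , g }
assocˡ (consʳ q) (consʳ p) = let _ , s , t , eq = assocˡ q p in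
  -, s , consʳ t , λ { (v ∷ γ) → let e , f , g = eq γ in e , f , cong (v ∷_) g }

-- Reassociate, swap `B` with `C`, and reassociate back.
exchangeˡ : (s : Split A B AB) (t : Split AB C X) →
            ∃[ AC ] Σ[ p ∈ Split A C AC ] Σ[ q ∈ Split AC B X ]
            (∀ γ → lft p (lft q γ) ≡ lft s (lft t γ) × rgt p (lft q γ) ≡ rgt t γ
                   × rgt q γ ≡ rgt s (lft t γ))
exchangeˡ s t =
  let _ , q₁ , p₁ , eq₁ = assocʳ s t
      _ , s₂ , t₂ , eq₂ = assocˡ q₁ (swap p₁)
  in -, s₂ , t₂ , λ γ →
     let e , f , g = eq₁ γ ; e′ , f′ , g′ = eq₂ γ in
     trans e′ e , trans f′ (trans (lft-swap p₁ _) g) , trans g′ (trans (rgt-swap p₁ _) f)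

exchangeʳ : (q : Split A BC X) (p : Split B C BC) →
            ∃[ AC ] Σ[ s ∈ Split B AC X ] Σ[ t ∈ Split A C AC ]
            (∀ γ → lft s γ ≡ lft p (rgt q γ) × lft t (rgt s γ) ≡ lft q γ
                   × rgt t (rgt s γ) ≡ rgt p (rgt q γ))
exchangeʳ q p =
  let _ , s₁ , t₁ , eq₁ = assocˡ q p
      _ , q₂ , p₂ , eq₂ = assocʳ (swap s₁) t₁
  in -, q₂ , p₂ , λ γ →
     let e , f , g = eq₁ γ ; e′ , f′ , g′ = eq₂ γ in
     trans e′ (trans (lft-swap s₁ _) f) , trans f′ (trans (rgt-swap s₁ _) e) , trans g′ g

-- Affine terms

-- Tm Γ τ f says that f is the meaning of an affine term; Fam Tm Θ Γ g that g is the meaning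
-- of a simultaneous substitution for Θ whose components share no variable of Γ.
-- Substitutions are term formers (clo), and each constructor leaves the meaning in its
-- result type a variable constrained by an equation, so no lemma on syntactic substitution
-- is needed and matching never has to unify functions.  bot stands for a variable of the
-- environment.
Pred : Set₁
Pred = (Γ : Ctx) (τ : Ty) → (Env Γ → Val τ) → Set

data Fam (P : Pred) : (Θ Γ : Ctx) → (Env Γ → Env Θ) → Set where
  []   : ∀ {h} → Fam P [] Γ h
  cons : ∀ {f g h} (s : Split Γ₁ Γ₂ Γ) → P Γ₁ σ f → Fam P Θ Γ₂ g →
         (∀ γ → h γ ≡ f (lft s γ) ∷ g (rgt s γ)) → Fam P (σ ∷ Θ) Γ h

data Tm : Pred where
  var : ∀ {f} (s : Split [ τ ] Γ₁ Γ) → (∀ γ → f γ ∷ [] ≡ lft s γ) → Tm Γ τ f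
  bot : ∀ {f} → (∀ γ → f γ ≡ constant 0F) → Tm Γ τ f
  lam : ∀ {f g} → Tm (σ ∷ Γ) τ g → (∀ γ v → f γ ∙ v ≡ g (v ∷ γ)) → Tm Γ (σ ⇒ τ) f
  app : ∀ {f g h} (s : Split Γ₁ Γ₂ Γ) → Tm Γ₁ (σ ⇒ τ) f → Tm Γ₂ σ g →
        (∀ γ → h γ ≡ f (lft s γ) ∙ g (rgt s γ)) → Tm Γ τ h
  clo : ∀ {f g h} → Tm Γ τ f → Fam Tm Γ Δ g → (∀ δ → h δ ≡ f (g δ)) → Tm Δ τ h

private variable
  P Q : Pred

Fam-cong : ∀ {g h} → Fam P Θ Γ g → (∀ γ → h γ ≡ g γ) → Fam P Θ Γ h
Fam-cong []                eq = []
Fam-cong (cons s t ts eq′) eq = cons s t ts (λ γ → trans (eq γ) (eq′ γ))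

Fam-map : (∀ {Γ τ f} → P Γ τ f → Q Γ τ f) → ∀ {g} → Fam P Θ Γ g → Fam Q Θ Γ g
Fam-map φ []               = []
Fam-map φ (cons s t ts eq) = cons s (φ t) (Fam-map φ ts) eq

Fam-join : ∀ {g h} (r : Split Θ₁ Θ₂ Θ) → Fam P Θ₁ Γ₁ g → Fam P Θ₂ Γ₂ h → (s : Split Γ₁ Γ₂ Γ) →
           Fam P Θ Γ (λ γ → join r (g (lft s γ)) (h (rgt s γ)))
Fam-join []        ts us s = []
Fam-join {h = h} (consˡ r) (cons {f = f} {g = g} s₁ t ts eq) us s =
  let _ , q , p , e = assocʳ s₁ s in
  cons q t (Fam-join r ts us p) λ γ → let e₁ , e₂ , e₃ = e γ in begin
    join (consˡ r) _ (h (rgt s γ))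
      ≡⟨ cong (λ θ → join (consˡ r) θ (h (rgt s γ))) (eq (lft s γ)) ⟩
    f (lft s₁ (lft s γ)) ∷ join r (g (rgt s₁ (lft s γ))) (h (rgt s γ))
      ≡⟨ cong₂ _∷_ (cong f e₁) (cong₂ (λ x y → join r (g x) (h y)) e₂ e₃) ⟨
    f (lft q γ) ∷ join r (g (lft p (rgt q γ))) (h (rgt p (rgt q γ))) ∎
  where open ≡-Reasoning
Fam-join {g = g} (consʳ r) ts (cons {f = f} {g = h} s₂ u us eq) s =
  let _ , q , p , e = exchangeʳ s s₂ in
  cons q u (Fam-join r ts us p) λ γ → let e₁ , e₂ , e₃ = e γ in begin
    join (consʳ r) (g (lft s γ)) _
      ≡⟨ cong (join (consʳ r) (g (lft s γ))) (eq (rgt s γ)) ⟩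
    f (lft s₂ (rgt s γ)) ∷ join r (g (lft s γ)) (h (rgt s₂ (rgt s γ)))
      ≡⟨ cong₂ _∷_ (cong f e₁) (cong₂ (λ x y → join r (g x) (h y)) e₂ e₃) ⟨
    f (lft q γ) ∷ join r (g (lft p (rgt q γ))) (h (rgt p (rgt q γ))) ∎
  where open ≡-Reasoning

-- Each component owns its variables, so a splitting of `Θ` induces one of `Γ`. This is how a
-- substitution is distributed over an application without breaking affinity.
Fam-split : ∀ {h} (r : Split Θ₁ Θ₂ Θ) → Fam P Θ Γ h →
            ∃[ Γ₁ ] ∃[ Γ₂ ] Σ[ s ∈ Split Γ₁ Γ₂ Γ ] ∃[ h₁ ] ∃[ h₂ ]
            (Fam P Θ₁ Γ₁ h₁ × Fam P Θ₂ Γ₂ h₂ ×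
             (∀ γ → lft r (h γ) ≡ h₁ (lft s γ)) × (∀ γ → rgt r (h γ) ≡ h₂ (rgt s γ)))
Fam-split [] [] = -, -, allʳ , (λ _ → []) , (λ _ → []) , [] , [] , (λ _ → refl) , λ _ → refl
Fam-split (consˡ r) (cons {f = f} q t ts eq) =
  let _ , _ , p , h₁ , h₂ , ts₁ , ts₂ , eqˡ , eqʳ = Fam-split r ts
      _ , s₁ , s , e = assocˡ q p
  in -, -, s , (λ γ → f (lft s₁ γ) ∷ h₁ (rgt s₁ γ)) , h₂ ,
     cons s₁ t ts₁ (λ _ → refl) , ts₂ ,
     (λ γ → let e₁ , e₂ , e₃ = e γ in
       trans (cong (lft (consˡ r)) (eq γ))
         (cong₂ _∷_ (cong f (sym e₁)) (trans (eqˡ _) (cong h₁ (sym e₂))))) ,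
     (λ γ → let e₁ , e₂ , e₃ = e γ in
       trans (cong (rgt (consˡ r)) (eq γ)) (trans (eqʳ _) (cong h₂ (sym e₃))))
Fam-split (consʳ r) (cons {f = f} q t ts eq) =
  let _ , _ , p , h₁ , h₂ , ts₁ , ts₂ , eqˡ , eqʳ = Fam-split r ts
      _ , s , s₂ , e = exchangeʳ q p
  in -, -, s , h₁ , (λ γ → f (lft s₂ γ) ∷ h₂ (rgt s₂ γ)) ,
     ts₁ , cons s₂ t ts₂ (λ _ → refl) ,
     (λ γ → let e₁ , e₂ , e₃ = e γ in
       trans (cong (lft (consʳ r)) (eq γ)) (trans (eqˡ _) (cong h₁ (sym e₁)))) ,
     (λ γ → let e₁ , e₂ , e₃ = e γ in
       trans (cong (rgt (consʳ r)) (eq γ))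
         (cong₂ _∷_ (cong f (sym e₂)) (trans (eqʳ _) (cong h₂ (sym e₃)))))

Fam-weaken : ∀ {g h} (s : Split Γ₁ Γ₂ Γ) → Fam P Θ Γ₁ g → (∀ γ → h γ ≡ g (lft s γ)) → Fam P Θ Γ h
Fam-weaken s ts eq =
  Fam-cong (Fam-join {h = λ _ → []} allˡ ts [] s) (λ γ → trans (eq γ) (sym (join-allˡ _)))

Fam-id : (∀ {σ} → P [ σ ] σ head) → Fam P Γ Γ id
Fam-id {Γ = []}    φ = []
Fam-id {Γ = σ ∷ Γ} φ =
  cons (consˡ allʳ) φ (Fam-id φ) λ { (v ∷ γ) → cong (v ∷_) (sym (rgt-allʳ γ)) }

vars : Fam Tm Γ Γ id
vars = Fam-id (var (consˡ []) λ { (v ∷ []) → refl })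

bots : Fam Tm Θ Γ (λ _ → zeros)
bots {[]}    = []
bots {σ ∷ Θ} = cons allʳ (bot {f = λ _ → constant 0F} λ _ → refl) bots λ _ → refl

Tm-weaken : ∀ {f h} (s : Split Γ₁ Γ₂ Γ) → Tm Γ₁ τ f → (∀ γ → h γ ≡ f (lft s γ)) → Tm Γ τ h
Tm-weaken s t eq = clo t (Fam-weaken s vars (λ _ → refl)) eq

clo* : ∀ {f g} → Fam Tm Θ Γ f → Fam Tm Γ Δ g → Fam Tm Θ Δ (λ δ → f (g δ))
clo* []                                   us = []
clo* (cons {f = f} {g = g} s t ts eq) us =
  let _ , _ , p , h₁ , h₂ , us₁ , us₂ , eqˡ , eqʳ = Fam-split s us in
  cons p (clo {h = λ γ → f (h₁ γ)} t us₁ (λ _ → refl)) (clo* ts us₂) λ γ →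
    trans (eq _) (cong₂ (λ x y → f x ∷ g y) (eqˡ γ) (eqʳ γ))

-- Head normal forms, by evaluation

-- Only the head is normal and the arguments are arbitrary terms: the proof inspects heads alone.
data Ne : Pred where
  var : ∀ {f} (s : Split [ τ ] Γ₁ Γ) → (∀ γ → f γ ∷ [] ≡ lft s γ) → Ne Γ τ f
  bot : ∀ {f} → (∀ γ → f γ ≡ constant 0F) → Ne Γ τ f
  app : ∀ {f g h} (s : Split Γ₁ Γ₂ Γ) → Ne Γ₁ (σ ⇒ τ) f → Tm Γ₂ σ g →
        (∀ γ → h γ ≡ f (lft s γ) ∙ g (rgt s γ)) → Ne Γ τ h

Ne⇒Tm : ∀ {f} → Ne Γ τ f → Tm Γ τ f
Ne⇒Tm (var s eq)     = var s eq
Ne⇒Tm (bot eq)       = bot eq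
Ne⇒Tm (app s n t eq) = app s (Ne⇒Tm n) t eq

Ne-weaken : ∀ {f h} (s : Split Γ₁ Γ₂ Γ) → Ne Γ₁ τ f → (∀ γ → h γ ≡ f (lft s γ)) → Ne Γ τ h
Ne-weaken s (var s′ eq′) eq =
  let _ , q , p , e = assocʳ s′ s in
  var q λ γ → trans (cong (_∷ []) (eq γ)) (trans (eq′ _) (sym (proj₁ (e γ))))
Ne-weaken s (bot eq′) eq = bot λ γ → trans (eq γ) (eq′ _)
Ne-weaken s (app {f = f} {g = g} s′ n t eq′) eq =
  let _ , q , p , e = assocʳ s′ s in
  app q n (Tm-weaken {h = λ γ → g (lft p γ)} p t (λ _ → refl)) λ γ → let e₁ , e₂ , _ = e γ in
    trans (eq γ) (trans (eq′ _) (cong₂ (λ x y → f x ∙ g y) (sym e₁) (sym e₂)))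

-- Reducible values.  An argument is spliced in from a disjoint context, so Kripke
-- extension becomes splitting.
V : Pred
V Γ (atom a) f = Ne Γ (atom a) f
V Γ (σ ⇒ τ)  f = Tm Γ (σ ⇒ τ) f ×
  (∀ {Δ X g h} (s : Split Γ Δ X) → V Δ σ g → (∀ γ → h γ ≡ f (lft s γ) ∙ g (rgt s γ)) → V X τ h)

V-weaken : ∀ {f h} (s : Split Γ₁ Γ₂ Γ) → V Γ₁ τ f → (∀ γ → h γ ≡ f (lft s γ)) → V Γ τ h
V-weaken {τ = atom _} s n       eq = Ne-weaken s n eq
V-weaken {τ = σ ⇒ τ} {f} s (t , F) eq = Tm-weaken s t eq , λ {_} {_} {g} s′ v eq′ →
  let _ , p , q , e = exchangeˡ s s′ in
  V-weaken {h = _} q (F p v (λ _ → refl)) λ γ → let e₁ , e₂ , _ = e γ in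
    trans (eq′ γ) (cong₂ _∙_ (trans (eq _) (cong f (sym e₁))) (cong g (sym e₂)))

reify : ∀ {f} → V Γ τ f → Tm Γ τ f
reify {τ = atom _} n       = Ne⇒Tm n
reify {τ = σ ⇒ τ}  (t , F) = t

reflect : ∀ {f} → Ne Γ τ f → V Γ τ f
reflect {τ = atom _} n = n
reflect {τ = σ ⇒ τ}  n = Ne⇒Tm n , λ s v eq → reflect (app s n (reify v) eq)

-- The fundamental lemma for `V`, by induction on the term. A closure is evaluated by first
-- evaluating its substitution with `eval*`, which keeps the recursion structural.
eval  : ∀ {f g h} → Tm Γ τ f → Fam V Γ Δ g → (∀ δ → h δ ≡ f (g δ)) → V Δ τ h
eval* : ∀ {f g} → Fam Tm Θ Γ f → Fam V Γ Δ g → Fam V Θ Δ (λ δ → f (g δ))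

eval {g = g} (var s eq′) vs eq with Fam-split s vs
... | _ , _ , p , h , _ , cons {f = f} p′ v [] eq″ , _ , eqˡ , _ =
  V-weaken p (V-weaken {h = λ γ → f (lft p′ γ)} p′ v (λ _ → refl)) λ γ →
    cong head {x = _ ∷ []} {y = _ ∷ []} (begin
      _ ∷ []       ≡⟨ cong (_∷ []) (eq γ) ⟩
      _ ∷ []       ≡⟨ eq′ _ ⟩
      lft s (g γ)  ≡⟨ eqˡ γ ⟩
      h (lft p γ)  ≡⟨ eq″ _ ⟩
      _            ≡⟨ cong (f (lft p′ (lft p γ)) ∷_) (Env-[] _) ⟩
      _ ∷ []       ∎)
  where open ≡-Reasoning
eval (bot eq′) vs eq = reflect (bot λ δ → trans (eq δ) (eq′ _))
eval {f = f} {g = g} (lam {g = k} t eq′) vs eq =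
  -- The term component may stay unnormalised, so the original abstraction under the reified family
  -- serves.
  clo (lam t eq′) (Fam-map reify vs) eq , λ {_} {_} {h} s v eq″ →
    eval t (cons {h = λ γ → h (lft (swap s) γ) ∷ g (rgt (swap s) γ)} (swap s) v vs (λ _ → refl))
      λ γ → begin
        _                                              ≡⟨ eq″ γ ⟩
        _                                              ≡⟨ cong (_∙ h (rgt s γ)) (eq _) ⟩
        f (g (lft s γ)) ∙ h (rgt s γ)                  ≡⟨ eq′ _ _ ⟩
        k (h (rgt s γ) ∷ g (lft s γ))
          ≡⟨ cong₂ (λ x y → k (h x ∷ g y)) (lft-swap s γ) (rgt-swap s γ) ⟨
        k (h (lft (swap s) γ) ∷ g (rgt (swap s) γ))    ∎
  where open ≡-Reasoning
eval (app {f = f} {g = g} s t u eq′) vs eq =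
  let _ , _ , p , h₁ , h₂ , vs₁ , vs₂ , eqˡ , eqʳ = Fam-split s vs in
  proj₂ (eval {h = λ γ → f (h₁ γ)} t vs₁ (λ _ → refl))
    p (eval {h = λ γ → g (h₂ γ)} u vs₂ (λ _ → refl)) λ γ →
      trans (eq γ) (trans (eq′ _) (cong₂ (λ x y → f x ∙ g y) (eqˡ γ) (eqʳ γ)))
eval (clo t ts eq′) vs eq = eval t (eval* ts vs) (λ δ → trans (eq δ) (eq′ _))

eval* [] vs = []
eval* (cons {f = f} {g = g} s t ts eq) vs =
  let _ , _ , p , h₁ , h₂ , vs₁ , vs₂ , eqˡ , eqʳ = Fam-split s vs in
  cons p (eval {h = λ γ → f (h₁ γ)} t vs₁ (λ _ → refl)) (eval* ts vs₂) λ γ →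
    trans (eq _) (cong₂ (λ x y → f x ∷ g y) (eqˡ γ) (eqʳ γ))

data HeadForm (Γ : Ctx) (a : ℕ) (f : Env Γ → Val (atom a)) : Set where
  bot : (∀ γ → f γ ≡ constant 0F) → HeadForm Γ a f
  app : ∀ {g} (s : Split [ Θ ⇛ atom a ] Γ₁ Γ) → Fam Tm Θ Γ₁ g →
        (∀ γ → f γ ≡ head (lft s γ) ∙* g (rgt s γ)) → HeadForm Γ a f

-- The arguments move one by one into the accumulated spine `g`. A head `bot` absorbs the whole
-- spine.
unwind : ∀ {f g h} → Ne Γ₁ (Θ ⇛ atom a) f → Fam Tm Θ Γ₂ g → (s : Split Γ₁ Γ₂ Γ) →
         (∀ γ → h γ ≡ f (lft s γ) ∙* g (rgt s γ)) → HeadForm Γ a h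
unwind {g = g} (var s′ eq′) ts s eq =
  let _ , q , p , e = assocʳ s′ s in
  app q (Fam-weaken {h = λ γ → g (rgt p γ)} (swap p) ts (λ γ → cong g (sym (lft-swap p γ))))
    λ γ → let e₁ , _ , e₃ = e γ in
      trans (eq γ) (cong₂ (λ x y → head x ∙* g y) (trans (eq′ _) (sym e₁)) (sym e₃))
unwind {g = g} (bot eq′) ts s eq =
  bot λ γ → trans (eq γ) (trans (cong (_∙* g (rgt s γ)) (eq′ _)) (constant-∙* 0F (g (rgt s γ))))
unwind {g = g} (app {f = f} {g = k} s′ n t eq′) ts s eq =
  let _ , q , p , e = assocʳ s′ s in
  unwind {g = λ γ → k (lft p γ) ∷ g (rgt p γ)} n (cons p t ts (λ _ → refl)) q λ γ →
    let e₁ , e₂ , e₃ = e γ in begin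
      _
        ≡⟨ eq γ ⟩
      _
        ≡⟨ cong (_∙* g (rgt s γ)) (eq′ _) ⟩
      f (lft s′ (lft s γ)) ∙ k (rgt s′ (lft s γ)) ∙* g (rgt s γ)
        ≡⟨ cong₂ (λ x y → x ∙* g y) (cong₂ (λ x y → f x ∙ k y) e₁ e₂) e₃ ⟨
      f (lft q γ) ∙ k (lft p (rgt q γ)) ∙* g (rgt p (rgt q γ)) ∎
  where open ≡-Reasoning

headForm : ∀ {f} → Tm Γ (atom a) f → HeadForm Γ a f
headForm {f = f} t =
  unwind {g = λ _ → []} (eval t (Fam-id (reflect (var (consˡ []) λ { (v ∷ []) → refl }))) (λ _ → refl)) [] allˡ
    (λ γ → cong f (sym (lft-allˡ γ)))

-- Operations on affine terms

only : ∀ {h} → Fam Tm [ σ ] Γ h → Tm Γ σ (λ γ → head (h γ))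
only (cons s t [] eq) = Tm-weaken s t (λ γ → cong head (eq γ))

apply* : ∀ {f g h} → Tm Γ₁ (Θ ⇛ τ) f → Fam Tm Θ Γ₂ g → (s : Split Γ₁ Γ₂ Γ) →
         (∀ γ → h γ ≡ f (lft s γ) ∙* g (rgt s γ)) → Tm Γ τ h
apply* {f = f} {g = g} t [] s eq =
  Tm-weaken s t λ γ → trans (eq γ) (cong (f (lft s γ) ∙*_) (Env-[] (g (rgt s γ))))
apply* {f = f} t (cons {f = k} {g = g} q u us eq′) s eq =
  let _ , p , s′ , e = assocˡ s q in
  apply* (app {h = λ γ → f (lft p γ) ∙ k (rgt p γ)} p t u (λ _ → refl)) us s′ λ γ →
    let e₁ , e₂ , e₃ = e γ in begin
      _                                                     ≡⟨ eq γ ⟩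
      _                                                     ≡⟨ cong (f (lft s γ) ∙*_) (eq′ _) ⟩
      f (lft s γ) ∙ k (lft q (rgt s γ)) ∙* g (rgt q (rgt s γ))
        ≡⟨ cong₂ (λ x y → x ∙* g y) (cong₂ (λ x y → f x ∙ k y) e₁ e₂) e₃ ⟨
      f (lft p (lft s′ γ)) ∙ k (rgt p (lft s′ γ)) ∙* g (rgt s′ γ) ∎
  where open ≡-Reasoning

-- The new function ignores its `Δ₂` arguments. It allows a coder that expects `x` with all
-- arguments `Δ` to be fed an `x` that takes only `Δ₁`.
extendArgs : (r : Split Δ₁ Δ₂ Δ) → Val (Δ₁ ⇛ τ) → Val (Δ ⇛ τ)
extendArgs r x = Λ* (λ ζ → x ∙* lft r ζ)

extendArgs-β : (r : Split Δ₁ Δ₂ Δ) (x : Val (Δ₁ ⇛ τ)) → ∀ ζ → extendArgs r x ∙* ζ ≡ x ∙* lft r ζ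
extendArgs-β r x = Λ*-β (λ ζ → x ∙* lft r ζ)

Tm-extendArgs : ∀ {f} (r : Split Δ₁ Δ₂ Δ) → Tm Γ (Δ₁ ⇛ τ) f → Tm Γ (Δ ⇛ τ) (λ γ → extendArgs r (f γ))
Tm-extendArgs []        t = t
Tm-extendArgs {f = f} (consˡ r) t =
  lam (Tm-extendArgs r (app {h = λ { (v ∷ γ) → f γ ∙ v }} (consʳ allˡ) t (only vars)
        λ { (v ∷ γ) → cong (λ y → f y ∙ v) (sym (lft-allˡ γ)) }))
    λ γ v → Λ-β _ v
Tm-extendArgs {f = f} (consʳ r) t =
  lam (Tm-extendArgs r (Tm-weaken {h = λ { (v ∷ γ) → f γ }} (consʳ allˡ) t
        λ { (v ∷ γ) → cong f (sym (lft-allˡ γ)) }))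
    λ γ v → Λ-β _ v

-- By affinity at most one member of a family depends on a given variable.
data Occurrence (P : Pred) (σ : Ty) (Γ Θ : Ctx) (h : Env (σ ∷ Γ) → Env Θ) : Set where
  absent  : ∀ {g} → Fam P Θ Γ g → (∀ v γ → h (v ∷ γ) ≡ g γ) → Occurrence P σ Γ Θ h
  present : ∀ {f g} (q : Split [ μ ] Θ₁ Θ) (p : Split Γ₁ Γ₂ Γ) → P (σ ∷ Γ₁) μ f → Fam P Θ₁ Γ₂ g →
            (∀ v γ → h (v ∷ γ) ≡ join q (f (v ∷ lft p γ) ∷ []) (g (rgt p γ))) →
            Occurrence P σ Γ Θ h

occurrence : ∀ {h} → Fam P Θ (σ ∷ Γ) h → Occurrence P σ Γ Θ h
occurrence {h = h} [] = absent {g = λ _ → []} [] (λ v γ → Env-[] (h (v ∷ γ)))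
occurrence (cons (consˡ s) t ts eq) = present (consˡ allʳ) s t ts λ v γ →
  trans (eq _) (cong (_ ∷_) (sym (join-allʳ _)))
occurrence (cons {f = f} (consʳ s) t ts eq) with occurrence ts
... | absent {g = g} ts′ eq′ =
  absent (cons {h = λ γ → f (lft s γ) ∷ g (rgt s γ)} s t ts′ (λ _ → refl)) λ v γ →
    trans (eq _) (cong (_ ∷_) (eq′ v _))
... | present {f = k} {g = g} q p u us eq′ =
  let _ , s₁ , s₂ , e = exchangeʳ s p in
  present {g = λ γ → f (lft s₂ γ) ∷ g (rgt s₂ γ)} (consʳ q) s₁ u (cons s₂ t us (λ _ → refl))
    λ v γ → let e₁ , e₂ , e₃ = e γ in begin
      _ ≡⟨ eq _ ⟩
      _ ≡⟨ cong (f (lft s γ) ∷_) (eq′ v _) ⟩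
      f (lft s γ) ∷ join q (k (v ∷ lft p (rgt s γ)) ∷ []) (g (rgt p (rgt s γ)))
        ≡⟨ cong₂ (λ x y → f x ∷ y) e₂ (cong₂ (λ x y → join q (k (v ∷ x) ∷ []) (g y)) e₁ e₃) ⟨
      f (lft s₂ (rgt s₁ γ)) ∷ join q (k (v ∷ lft s₁ γ) ∷ []) (g (rgt s₂ (rgt s₁ γ))) ∎
  where open ≡-Reasoning

-- Matchings

⇒-⇛-∼ : ∀ Γ → (σ ⇒ Γ ⇛ τ) ∼ (Γ ⇛ σ ⇒ τ)
⇒-⇛-∼ []      = ∼-refl
⇒-⇛-∼ (ρ ∷ Γ) = ∼-trans ∼-swap (∼-cong ∼-refl (⇒-⇛-∼ Γ))

↭⇒∼ : Γ ↭ Δ → (Γ ⇛ τ) ∼ (Δ ⇛ τ)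
↭⇒∼ ↭.refl          = ∼-refl
↭⇒∼ (↭.prep _ p)    = ∼-cong ∼-refl (↭⇒∼ p)
↭⇒∼ (↭.swap _ _ p)  = ∼-trans ∼-swap (∼-cong ∼-refl (∼-cong ∼-refl (↭⇒∼ p)))
↭⇒∼ (↭.trans p q)   = ∼-trans (↭⇒∼ p) (↭⇒∼ q)

-- A derivation plan for two types ending in `a`: `drop` and `pair` stand for N and H, and `group`
-- for one premise of D. In `group`, `∼` is allowed because the argument of type `σ` can occur at
-- any position in `τ`.
data Matching (a : ℕ) : Ctx → Ctx → Set where
  done  : Matching a [] []
  drop  : ∀ τ → Matching a Δ Θ → Matching a Δ (τ ∷ Θ)
  pair  : CF⊢ ρ ⊴¹ τ → Matching a Δ Θ → Matching a (ρ ∷ Δ) (τ ∷ Θ)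
  group : ∀ Σ → CF⊢ Δ₁ ⇛ atom a ⊴¹ σ → τ ∼ (Σ ⇛ σ ⇒ atom a) → Matching a Δ Θ →
          Matching a (Δ₁ ++ Δ) (τ ∷ Θ)
  perm  : Δ ↭ Δ₁ → Θ ↭ Θ₁ → Matching a Δ Θ → Matching a Δ₁ Θ₁

-- Rule D needs all its groups at once, so they are collected on the way to the leaf.
matching⇒CF′ : Matching a Δ Θ → ∀ {n} (Δs Σs : Fin n → Ctx) (σs : Fin n → Ty) →
               (∀ i → CF⊢ Δs i ⇛ atom a ⊴¹ σs i) →
               CF⊢ (Δ ++ concat (tabulate Δs)) ⇛ atom a
                 ⊴¹ (Θ ++ tabulate (λ i → Σs i ⇛ σs i ⇒ atom a)) ⇛ atom a
matching⇒CF′ done         Δs Σs σs ds = D Δs Σs σs ds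
matching⇒CF′ (drop τ m)   Δs Σs σs ds = N [ τ ] (matching⇒CF′ m Δs Σs σs ds)
matching⇒CF′ (pair d m)   Δs Σs σs ds = H d (matching⇒CF′ m Δs Σs σs ds)
matching⇒CF′ {Θ = _ ∷ Θ} (group {Δ₁ = Δ₁} {σ = σ} {Δ = Δ} Σ d eq m) Δs Σs σs ds =
  ∼-conv (↭⇒∼ (↭-trans (shifts Δ Δ₁) (↭-reflexive (sym (++-assoc Δ₁ Δ _)))))
    (∼-trans (↭⇒∼ (shift _ Θ _)) (∼-cong (∼-sym eq) ∼-refl))
    (matching⇒CF′ m (Δ₁ Vector.∷ Δs) (Σ Vector.∷ Σs) (σ Vector.∷ σs)
      λ { zero → d ; (suc i) → ds i })
matching⇒CF′ (perm p q m) Δs Σs σs ds =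
  ∼-conv (↭⇒∼ (++⁺ʳ _ p)) (↭⇒∼ (++⁺ʳ _ q)) (matching⇒CF′ m Δs Σs σs ds)

matching⇒CF : Matching a Δ Θ → CF⊢ Δ ⇛ atom a ⊴¹ Θ ⇛ atom a
matching⇒CF {Δ = Δ} {Θ = Θ} m =
  ∼-conv (↭⇒∼ (↭-reflexive (++-identityʳ Δ))) (↭⇒∼ (↭-reflexive (++-identityʳ Θ)))
    (matching⇒CF′ m {zero} (λ ()) (λ ()) (λ ()) λ ())

dropAll : ∀ Θ → Matching a Δ Γ → Matching a Δ (Θ ++ Γ)
dropAll []      m = m
dropAll (τ ∷ Θ) m = drop τ (dropAll Θ m)

-- Retractions in the model

view : ∀ τ → ∃[ Θ ] ∃[ a ] τ ≡ Θ ⇛ atom a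
view (atom a) = [] , a , refl
view (σ ⇒ τ)  = let Θ , a , eq = view τ in σ ∷ Θ , a , cong (σ ⇒_) eq

⇒-injectiveˡ : ∀ {σ′ τ′} → σ ⇒ τ ≡ σ′ ⇒ τ′ → σ ≡ σ′
⇒-injectiveˡ refl = refl

⇒-injectiveʳ : ∀ {σ′ τ′} → σ ⇒ τ ≡ σ′ ⇒ τ′ → τ ≡ τ′
⇒-injectiveʳ refl = refl

⇛-injective : ∀ Γ Δ → Γ ⇛ atom a ≡ Δ ⇛ atom b → Γ ≡ Δ
⇛-injective []      []      eq = refl
⇛-injective (_ ∷ Γ) (_ ∷ Δ) eq with refl ← ⇒-injectiveˡ eq =
  cong (_ ∷_) (⇛-injective Γ Δ (⇒-injectiveʳ eq))

-- The retract Δ ⇛ b is kept uncurried in the decoder, which also binds the arguments of x.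
record Retract (Δ : Ctx) (b : ℕ) (τ : Ty) : Set where
  field
    {c}      : Env [ Δ ⇛ atom b ] → Val τ
    {d}      : Env (τ ∷ Δ) → Val (atom b)
    coder    : Tm [ Δ ⇛ atom b ] τ c
    decoder  : Tm (τ ∷ Δ) (atom b) d
    retracts : ∀ x ζ → d (c (x ∷ []) ∷ ζ) ≡ x ∙* ζ

-- args are the T⃗ that the decoder passes to y, in the variables z⃗ : Δ; coder is the C of the
-- introduction.
record Solution (Δ Θ : Ctx) (a : ℕ) : Set where
  field
    {t}    : Env Δ → Env Θ
    {c}    : Env (Δ ⇛ atom a ∷ Θ) → Val (atom a)
    args   : Fam Tm Θ Δ t
    coder  : Tm (Δ ⇛ atom a ∷ Θ) (atom a) c
    solves : ∀ x ζ → c (x ∷ t ζ) ≡ x ∙* ζ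

retract⇒solution : Retract Δ b τ → ∃[ Θ ] τ ≡ Θ ⇛ atom b × Solution Δ Θ b
retract⇒solution {Δ} {b} {τ} R with headForm decoder
  where open Retract R
... | bot eq = ⊥-elim (constant-≢ {atom b} (begin
    constant 1F                            ≡⟨ constant-∙* {Δ} 1F zeros ⟨
    constant 1F ∙* zeros {Δ}                ≡⟨ retracts (constant 1F) zeros ⟨
    d (c (constant 1F ∷ []) ∷ zeros)       ≡⟨ eq _ ⟩
    constant 0F                            ∎))
  where
  open Retract R
  open ≡-Reasoning
-- The head is one of the z⃗, which `zeros` interprets by 0.
... | app {g = g} (consʳ s) ts eq = ⊥-elim (constant-≢ {atom b} (begin
    constant 1F                            ≡⟨ constant-∙* {Δ} 1F zeros ⟨
    constant 1F ∙* zeros {Δ}                ≡⟨ retracts (constant 1F) zeros ⟨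
    d (c (constant 1F ∷ []) ∷ zeros)       ≡⟨ eq _ ⟩
    head (lft s zeros) ∙* g (c (constant 1F ∷ []) ∷ rgt s zeros)
      ≡⟨ cong (λ y → head y ∙* g (c (constant 1F ∷ []) ∷ rgt s zeros)) (lft-zeros s) ⟩
    constant 0F ∙* g (c (constant 1F ∷ []) ∷ rgt s zeros)
      ≡⟨ constant-∙* 0F (g (c (constant 1F ∷ []) ∷ rgt s zeros)) ⟩
    constant 0F                            ∎))
  where
  open Retract R
  open ≡-Reasoning
-- The head is the code y. Its type determines `τ`, and the coder applied to fresh variables of
-- types `Θ` becomes the coder of the solution.
... | app {Θ = Θ} {g = g} (consˡ s) ts eq = Θ , refl , record
  { args   = Fam-weaken {h = λ ζ → g (rgt s ζ)} (swap s) ts λ ζ → cong g (sym (lft-swap s ζ))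
  ; coder  = apply* {h = λ { (x ∷ θ) → c (x ∷ []) ∙* θ }} coder vars (consˡ allʳ)
               λ { (x ∷ θ) → cong₂ (λ y z → c (x ∷ y) ∙* z) (sym (Env-[] _)) (sym (rgt-allʳ θ)) }
  ; solves = λ x ζ → trans (sym (eq _)) (retracts x ζ)
  }
  where open Retract R

closeRight : ∀ {f} → Tm (σ ∷ Γ) τ f → Tm [ σ ] τ (λ γ → f (head γ ∷ zeros))
closeRight {f = f} t = clo t
  (cons {g = λ _ → zeros} {h = λ γ → head γ ∷ zeros} (consˡ []) (only vars) bots
    λ { (v ∷ []) → refl })
  λ { (v ∷ []) → refl }

-- If no member of `T` contained `v`, the composite could not return both 0 and 1. The one member
-- that does, with its other variables at 0, is the coder. `U` is the decoder, its other inputs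
-- being the remaining members at `zeros`.
retractOf : ∀ {u t} → Tm Θ (Δ ⇛ atom b) u → Fam Tm Θ ((Δ ⇛ atom b) ∷ Γ) t →
            (∀ v → u (t (v ∷ zeros)) ≡ v) →
            ∃[ μ ] ∃[ Θ₁ ] Split [ μ ] Θ₁ Θ × Retract Δ b μ
retractOf {Δ = Δ} {b} {u = u} U T eq with occurrence T
... | absent {g = g} _ eq′ = ⊥-elim (constant-≢ (begin
    constant 1F                      ≡⟨ eq (constant 1F) ⟨
    u _                              ≡⟨ cong u (eq′ _ _) ⟩
    u (g zeros)                      ≡⟨ cong u (eq′ _ _) ⟨
    u _                              ≡⟨ eq (constant 0F) ⟩
    constant {Δ ⇛ atom b} 0F         ∎))
  where open ≡-Reasoning
... | present {f = f} {g = g} q p t ts eq′ = -, -, q , record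
  { c        = λ γ → f (head γ ∷ zeros)
  ; d        = λ { (v ∷ ζ) → u (join q (v ∷ []) (g zeros)) ∙* ζ }
  ; coder    = closeRight t
  ; decoder  = apply* (clo {g = λ γ → join q γ (g zeros)} U
                 (Fam-cong (Fam-join q vars (clo* ts bots) allˡ)
                   λ γ → cong (λ y → join q y (g zeros)) (sym (lft-allˡ γ))) (λ _ → refl))
                 vars (consˡ allʳ)
                 λ { (v ∷ ζ) → cong₂ (λ y z → u (join q (v ∷ y) (g zeros)) ∙* z)
                       (sym (Env-[] _)) (sym (rgt-allʳ ζ)) }
  ; retracts = λ x ζ → cong (_∙* ζ) (begin
      u (join q (f (x ∷ zeros) ∷ []) (g zeros))
        ≡⟨ cong₂ (λ y z → u (join q (f (x ∷ y) ∷ []) (g z))) (lft-zeros p) (rgt-zeros p) ⟨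
      u (join q (f (x ∷ lft p zeros) ∷ []) (g (rgt p zeros)))
        ≡⟨ cong u (eq′ x zeros) ⟨
      u _
        ≡⟨ eq x ⟩
      x ∎)
  }
  where open ≡-Reasoning

-- Sizes

-- Counting atoms is additive over splittings, and the final atom makes `Θ ⇛ atom a` strictly larger
-- than `Θ`.
size : Ty → ℕ
size (atom _) = 1
size (σ ⇒ τ)  = size σ + size τ

size* : Ctx → ℕ
size* Γ = sum (map size Γ)

size-⇛ : ∀ Θ → size (Θ ⇛ atom a) ≡ suc (size* Θ)
size-⇛ []      = refl
size-⇛ {a} (σ ∷ Θ) = trans (cong (size σ +_) (size-⇛ {a} Θ)) (+-suc (size σ) (size* Θ))

size*-split : Split A B X → size* X ≡ size* A + size* B
size*-split {A} {B} s = trans (sum-↭ (map⁺ size (toPermutation s)))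
  (trans (cong sum (map-++ size A B)) (sum-++ (map size A) (map size B)))

size*-lft : Split A B X → size* A ≤ size* X
size*-lft {A} {B} {X} s = subst (size* A ≤_) (sym (size*-split s)) (m≤m+n (size* A) (size* B))

size*-rgt : Split A B X → size* B ≤ size* X
size*-rgt {A} {B} {X} s = subst (size* B ≤_) (sym (size*-split s)) (m≤n+m (size* B) (size* A))

size-pick : Split [ μ ] B X → size μ ≤ size* X
size-pick {μ} {X = X} s = subst (_≤ size* X) (+-identityʳ (size μ)) (size*-lft s)

-- Coders with head x

pairs : ∀ n → (∀ {Δ b τ} → size τ ≤ n → Retract Δ b τ → CF⊢ Δ ⇛ atom b ⊴¹ τ) →
        ∀ {u t} → size* Θ ≤ n → Fam Tm Δ Θ u → Fam Tm Θ Δ t → (∀ ζ → u (t ζ) ≡ ζ) → Matching a Δ Θ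
pairs n ih {u} {t} ≤n [] T eq = perm ↭.refl (↭-reflexive (++-identityʳ _)) (dropAll _ done)
pairs n ih {u} {t} ≤n (cons {σ = ρ} {f = f} {g = g} s U Us eq′) T eq = helper (Fam-split s T)
  where
  eqs : ∀ v ζ → f (lft s (t (v ∷ ζ))) ∷ g (rgt s (t (v ∷ ζ))) ≡ v ∷ ζ
  eqs v ζ = trans (sym (eq′ _)) (eq (v ∷ ζ))

  helper : ∃[ Γ₁ ] ∃[ Γ₂ ] Σ[ r ∈ Split Γ₁ Γ₂ _ ] ∃[ h₁ ] ∃[ h₂ ]
           (Fam Tm _ Γ₁ h₁ × Fam Tm _ Γ₂ h₂ ×
           (∀ γ → lft s (t γ) ≡ h₁ (lft r γ)) × (∀ γ → rgt s (t γ) ≡ h₂ (rgt r γ))) → Matching _ _ _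
  -- Here z_j lies outside the variables available to the first component of `U`, which nevertheless
  -- has to return it.
  helper (_ , _ , consʳ r , t₁ , _ , _ , _ , eqˡ , _) = ⊥-elim (constant-≢ (begin
      constant 1F              ≡⟨ cong head (eqs (constant 1F) zeros) ⟨
      f (lft s (t _))          ≡⟨ cong f (eqˡ _) ⟩
      f (t₁ (lft r zeros))     ≡⟨ cong f (eqˡ _) ⟨
      f (lft s (t _))          ≡⟨ cong head (eqs (constant 0F) zeros) ⟩
      constant 0F              ∎))
    where open ≡-Reasoning
  helper (_ , _ , consˡ r , t₁ , t₂ , T₁ , T₂ , eqˡ , eqʳ) with view ρ
  ... | Δ , b , refl =
    let μ , Θ₁ , q , R = retractOf {Δ = Δ} {b} U T₁ λ v → begin
          f (t₁ (v ∷ zeros))           ≡⟨ cong (λ y → f (t₁ (v ∷ y))) (lft-zeros r) ⟨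
          f (t₁ (v ∷ lft r zeros))     ≡⟨ cong f (eqˡ _) ⟨
          f (lft s (t (v ∷ zeros)))    ≡⟨ cong head (eqs v zeros) ⟩
          v                            ∎
    in perm ↭.refl
         (↭-sym (↭-trans (toPermutation s) (++⁺ʳ _ (toPermutation q))))
         (pair (ih (≤-trans (size-pick q) (≤-trans (size*-lft s) ≤n)) R)
           (dropAll Θ₁ (pairs n ih (≤-trans (size*-rgt s) ≤n) Us
             (Fam-weaken {h = λ ζ → t₂ (rgt r ζ)} (swap r) T₂ λ ζ → cong t₂ (sym (lft-swap r ζ)))
             -- The right part does not contain the variable just matched, so any value, here 0, can
             -- stand for it.
             λ ζ → trans (cong g (sym (eqʳ _))) (cong tail (eqs (constant 0F) ζ)))))
    where open ≡-Reasoning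

-- Coders whose head is an argument

-- `M` lists the argument types of the head y_i, and `ν` is the type of the argument that contains
-- `x`. `Δ′` types the variables allotted to T_i, and `Θ` is what is left after removing the type of
-- y_i.
record GroupStep (Δ Θ M : Ctx) (a : ℕ) : Set where
  field
    {ν}        : Ty
    {M′ Δ′ Δ″} : Ctx
    target     : Split [ ν ] M′ M
    source     : Split Δ′ Δ″ Δ
    retract    : Retract Δ′ a ν
    rest       : Solution Δ″ Θ a

groupStep : (S : Solution Δ Θ a) (s : Split [ Γ ⇛ atom a ] Θ₁ Θ) → ∀ {u} →
            Fam Tm Γ (Δ ⇛ atom a ∷ Θ₁) u →
            (∀ x θ → Solution.c S (x ∷ θ) ≡ head (lft s θ) ∙* u (x ∷ rgt s θ)) →
            GroupStep Δ Θ₁ Γ a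
groupStep {Δ} {Θ} {a} {Γ} {Θ₁} S s {u} U eq
  with r₁ , r₂ , r , t₁ , t₂ , T₁ , T₂ , eqˡ , eqʳ ← Fam-split s (Solution.args S)
  with occurrence U
-- Without `x` in any argument the coder would not depend on `x`, and `solves` would give it both
-- values.
... | absent {g = g} _ eq′ = ⊥-elim (constant-≢ (begin
    constant 1F                             ≡⟨ value 1F ⟨
    head (lft s (t zeros)) ∙* g (rgt s (t zeros)) ≡⟨ value 0F ⟩
    constant {atom a} 0F                    ∎))
  where
  open ≡-Reasoning
  open Solution S
  value : ∀ i → head (lft s (t zeros)) ∙* g (rgt s (t zeros)) ≡ constant i
  value i = begin
    head (lft s (t zeros)) ∙* g (rgt s (t zeros))
      ≡⟨ cong (head (lft s (t zeros)) ∙*_) (eq′ (constant i) (rgt s (t zeros))) ⟨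
    _                                         ≡⟨ eq (constant i) (t zeros) ⟨
    c (constant i ∷ t zeros)                  ≡⟨ solves (constant i) zeros ⟩
    constant i ∙* zeros {Δ}                   ≡⟨ constant-∙* i (zeros {Δ}) ⟩
    constant i                                ∎
... | present {μ = μ} {f = f} {g = g} q p V₁ Vs eq′
  -- The T⃗ other than T_i are divided between the argument containing `x` and its siblings. At
  -- `zeros` the former go into the coder and the latter into the decoder.
  with _ , _ , k , a₁ , a₂ , A₁ , A₂ , eqˡ′ , eqʳ′ ← Fam-split p T₂ = record
  { target  = q
  ; source  = r
  ; retract = record
    { c        = λ γ → f (extendArgs r (head γ) ∷ a₁ zeros)
    ; d        = λ { (v ∷ ζ) → head (t₁ ζ) ∙* join q (v ∷ []) (g (a₂ zeros)) }
    ; coder    = clo {g = λ γ → extendArgs r (head γ) ∷ a₁ zeros} V₁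
                   (cons allˡ (Tm-extendArgs r (only vars)) (clo* A₁ bots)
                     λ γ → cong (λ y → extendArgs r (head y) ∷ a₁ zeros) (sym (lft-allˡ γ)))
                   (λ _ → refl)
    ; decoder  = apply* {g = λ γ → join q γ (g (a₂ zeros))} (only T₁)
                   (Fam-cong (Fam-join q vars (clo* Vs (clo* A₂ bots)) allˡ)
                     λ γ → cong (λ y → join q y (g (a₂ zeros))) (sym (lft-allˡ γ)))
                   (consʳ allˡ)
                   λ { (v ∷ ζ) → cong₂ (λ y z → head (t₁ y) ∙* join q (v ∷ z) (g (a₂ zeros)))
                         (sym (lft-allˡ ζ)) (sym (Env-[] _)) }
    -- The original equation is taken at an `x` ignoring `Δ″` and at `ζ` padded with zeros on `Δ″`.
    ; retracts = λ x ζ → let δ = join r ζ zeros in begin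
        head (t₁ ζ) ∙* join q (f (extendArgs r x ∷ a₁ zeros) ∷ []) (g (a₂ zeros))
          ≡⟨ cong₂ (λ y z → head (t₁ ζ) ∙* join q (f (extendArgs r x ∷ a₁ y) ∷ []) (g (a₂ z)))
               (lft-zeros k) (rgt-zeros k) ⟨
        head (t₁ ζ) ∙* join q (f (extendArgs r x ∷ a₁ (lft k zeros)) ∷ []) (g (a₂ (rgt k zeros)))
          ≡⟨ cong₂ (λ y z → head (t₁ y) ∙* join q (f (extendArgs r x ∷ a₁ (lft k z)) ∷ []) (g (a₂ (rgt k z))))
               
               (lft-join r ζ zeros) (rgt-join r ζ zeros) ⟨
        head (t₁ (lft r δ)) ∙* join q (f (extendArgs r x ∷ a₁ (lft k (rgt r δ))) ∷ []) (g (a₂ (rgt k (rgt r δ))))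
          ≡⟨ cong₂ (λ y z → head y ∙* z) (eqˡ δ)
               (cong₂ (λ y z → join q (f (extendArgs r x ∷ y) ∷ []) (g z))
                 (trans (cong (lft p) (eqʳ δ)) (eqˡ′ _)) (trans (cong (rgt p) (eqʳ δ)) (eqʳ′ _))) ⟨
        head (lft s (t δ)) ∙* join q (f (extendArgs r x ∷ lft p (rgt s (t δ))) ∷ []) (g (rgt p (rgt s (t δ))))
          ≡⟨ cong (head (lft s (t δ)) ∙*_) (eq′ (extendArgs r x) (rgt s (t δ))) ⟨
        head (lft s (t δ)) ∙* u (extendArgs r x ∷ rgt s (t δ))
          ≡⟨ eq (extendArgs r x) (t δ) ⟨
        c (extendArgs r x ∷ t δ)
          ≡⟨ solves (extendArgs r x) δ ⟩
        extendArgs r x ∙* δ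
          ≡⟨ extendArgs-β r x δ ⟩
        x ∙* lft r δ
          ≡⟨ cong (x ∙*_) (lft-join r ζ zeros) ⟩
        x ∙* ζ ∎
    }
  -- The roles are exchanged: y_i becomes T_i at `zeros`, and `x` is made to ignore `Δ′`.
  ; rest    = record
    { args   = T₂
    ; coder  = clo {g = λ { (x ∷ θ) → extendArgs (swap r) x ∷ join s (t₁ zeros) θ }} coder
                 (cons {f = λ γ → extendArgs (swap r) (head γ)}
                   {g = λ θ → join s (t₁ zeros) θ} (consˡ allʳ) (Tm-extendArgs (swap r) (only vars))
                   (Fam-cong (Fam-join s (clo* T₁ bots) vars allʳ)
                     λ θ → cong (join s (t₁ zeros)) (sym (rgt-allʳ θ)))
                   λ { (x ∷ θ) → cong (λ y → _ ∷ join s (t₁ zeros) y) (sym (rgt-allʳ θ)) })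
                 (λ _ → refl)
    ; solves = λ x ζ → let δ = join r zeros ζ in begin
        c (extendArgs (swap r) x ∷ join s (t₁ zeros) (t₂ ζ))
          ≡⟨ cong₂ (λ y z → c (extendArgs (swap r) x ∷ join s (t₁ y) (t₂ z)))
               (lft-join r zeros ζ) (rgt-join r zeros ζ) ⟨
        c (extendArgs (swap r) x ∷ join s (t₁ (lft r δ)) (t₂ (rgt r δ)))
          ≡⟨ cong₂ (λ y z → c (extendArgs (swap r) x ∷ join s y z)) (eqˡ δ) (eqʳ δ) ⟨
        c (extendArgs (swap r) x ∷ join s (lft s (t δ)) (rgt s (t δ)))
          ≡⟨ cong (λ y → c (extendArgs (swap r) x ∷ y)) (join-lft-rgt s (t δ)) ⟩
        c (extendArgs (swap r) x ∷ t δ)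
          ≡⟨ solves (extendArgs (swap r) x) δ ⟩
        extendArgs (swap r) x ∙* δ
          ≡⟨ extendArgs-β (swap r) x δ ⟩
        x ∙* lft (swap r) δ
          ≡⟨ cong (x ∙*_) (trans (lft-swap r δ) (rgt-join r zeros ζ)) ⟩
        x ∙* ζ ∎
    }
  }
  where
  open ≡-Reasoning
  open Solution S

-- Test with the characteristic function of `v`.
separate : {v w : Val σ} → (∀ (φ : Val σ → Val (atom a)) → φ v ≡ φ w) → v ≡ w
separate {a = a} {v} {w} eq
  with code w ≟ code v | eq (λ y → if does (code y ≟ code v) then constant 1F else constant 0F)
... | yes e | _ = cong ⟨_⟩ (sym e)
... | no _  | e with code v ≟ code v
...   | yes _ = ⊥-elim (constant-≢ {atom a} e)
...   | no ¬e = ⊥-elim (¬e refl)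

-- Fullness of the model supplies enough `x`: those that apply an arbitrary test to the first
-- argument, and those that ignore it.
∙*-cancel : {ζ ζ′ : Env Δ} → (∀ (x : Val (Δ ⇛ atom a)) → x ∙* ζ ≡ x ∙* ζ′) → ζ ≡ ζ′
∙*-cancel {ζ = []}    {[]}     eq = refl
∙*-cancel {Δ = σ ∷ Δ} {a} {ζ = v ∷ ζ} {w ∷ ζ′} eq = cong₂ _∷_
  (separate {a = a} λ φ → let F = λ y → Λ* {Δ} (λ _ → φ y) in begin
    φ v                ≡⟨ Λ*-β (λ _ → φ v) ζ ⟨
    F v ∙* ζ           ≡⟨ cong (_∙* ζ) (Λ-β F v) ⟨
    Λ F ∙ v ∙* ζ       ≡⟨ eq (Λ F) ⟩
    Λ F ∙ w ∙* ζ′      ≡⟨ cong (_∙* ζ′) (Λ-β F w) ⟩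
    F w ∙* ζ′          ≡⟨ Λ*-β (λ _ → φ w) ζ′ ⟩
    φ w                ∎)
  (∙*-cancel λ x → begin
    x ∙* ζ                  ≡⟨ cong (_∙* ζ) (Λ-β (λ _ → x) v) ⟨
    Λ (λ _ → x) ∙ v ∙* ζ    ≡⟨ eq (Λ (λ _ → x)) ⟩
    Λ (λ _ → x) ∙ w ∙* ζ′   ≡⟨ cong (_∙* ζ′) (Λ-β (λ _ → x) w) ⟩
    x ∙* ζ′                 ∎)
  where open ≡-Reasoning

-- Completeness in the model

-- The bound `n` decreases in `match` only. The strict inequality there is paid for by the final
-- atom of `τ`, and it lets `retract⇒CF` be called at each member of `Θ`.
retract⇒CF : ∀ n → size τ ≤ n → Retract Δ b τ → CF⊢ Δ ⇛ atom b ⊴¹ τ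
match      : ∀ n → size* Θ < n → Solution Δ Θ a → Matching a Δ Θ

retract⇒CF n ≤n R with retract⇒solution R
... | Θ , refl , S = matching⇒CF (match n (subst (_≤ n) (size-⇛ Θ) ≤n) S)

match {Θ = Θ} {Δ = Δ} {a = a} (suc n) (s≤s ≤n) S with headForm (Solution.coder S)
... | bot eq = ⊥-elim (constant-≢ {atom a} (begin
    constant 1F                ≡⟨ constant-∙* 1F (zeros {Δ}) ⟨
    constant 1F ∙* zeros {Δ}   ≡⟨ solves (constant 1F) zeros ⟨
    c (constant 1F ∷ t zeros)  ≡⟨ eq _ ⟩
    constant 0F                ∎))
  where
  open ≡-Reasoning
  open Solution S
-- The head is `x`. Once injectivity identifies `Γ` with `Δ`, `e` equates a type with itself and can
-- be matched with `refl`.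
... | app {Θ = Γ} {g = u} (e ∷ˡ s) U eq with refl ← ⇛-injective Γ Δ e | refl ← e =
  pairs n (retract⇒CF n) ≤n
    (Fam-weaken {h = λ θ → u (rgt s θ)} (swap s) U λ θ → cong u (sym (lft-swap s θ))) args
    λ ζ → ∙*-cancel λ x → trans (sym (eq _)) (solves x ζ)
  where open Solution S
... | app {Θ = Γ} (_∷ʳ_ {r = Θ₁} refl s) U eq =
  perm (↭-sym (toPermutation source)) (↭-sym (toPermutation s))
    (group M′ (retract⇒CF n (≤-trans (size-pick target) (≤-trans (n≤1+n _) Γ≤n)) retract)
      -- The argument containing `x` is moved to the last place, the form that rule D has.
      (∼-trans (↭⇒∼ (toPermutation target)) (⇒-⇛-∼ M′))
      (match n Θ₁<n rest))
  where
  open GroupStep (groupStep S s U λ x θ → eq (x ∷ θ))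
  open ≤-Reasoning
  Γ≤n : suc (size* Γ) ≤ n
  Γ≤n = begin
    suc (size* Γ)     ≡⟨ size-⇛ {a} Γ ⟨
    size (Γ ⇛ atom a) ≤⟨ size-pick s ⟩
    size* Θ           ≤⟨ ≤n ⟩
    n                 ∎
  Θ₁<n : size* Θ₁ < n
  Θ₁<n = begin
    suc (size* Θ₁)                     ≤⟨ +-monoˡ-≤ (size* Θ₁) (s≤s z≤n) ⟩
    suc (size* Γ) + size* Θ₁           ≡⟨ cong (_+ size* Θ₁) (size-⇛ {a} Γ) ⟨
    size (Γ ⇛ atom a) + size* Θ₁       ≡⟨ cong (_+ size* Θ₁) (+-identityʳ _) ⟨
    size* [ Γ ⇛ atom a ] + size* Θ₁    ≡⟨ size*-split s ⟨
    size* Θ                            ≤⟨ ≤n ⟩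
    n                                  ∎

-- Interpretation of terms

Vals : Ctx → Set
Vals Γ = ∀ {σ} → σ ∈ Γ → Val σ

extend : Val σ → Vals Γ → Vals (σ ∷ Γ)
extend v f (here refl) = v
extend v f (there x)   = f x

⟦_⟧ : Γ ⊢ τ → Vals Γ → Val τ
⟦ var x ⟧ f = f x
⟦ ƛ t ⟧   f = Λ (λ v → ⟦ t ⟧ (extend v f))
⟦ t · u ⟧ f = ⟦ t ⟧ f ∙ ⟦ u ⟧ f

Λ-cong : {f g : Val σ → Val τ} → (∀ v → f v ≡ g v) → Λ f ≡ Λ g
Λ-cong {f = f} {g} eq = ∙-ext λ v → trans (Λ-β f v) (trans (eq v) (sym (Λ-β g v)))

occurrences-index : (x : τ ∈ Γ) → occurrences (index x) (var x) ≢ 0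
occurrences-index x with index x ≟ index x
... | yes _ = λ ()
... | no ¬e = ⊥-elim (¬e refl)

-- Needed because dividing the variables at an application resets those of the other side to 0.
⟦⟧-agree : (t : Γ ⊢ τ) {f g : Vals Γ} →
           (∀ {σ} (x : σ ∈ Γ) → occurrences (index x) t ≢ 0 → f x ≡ g x) → ⟦ t ⟧ f ≡ ⟦ t ⟧ g
⟦⟧-agree (var x) eq = eq x (occurrences-index x)
⟦⟧-agree (ƛ t)   eq = Λ-cong λ v → ⟦⟧-agree t λ { (here refl) _ → refl ; (there x) → eq x }
⟦⟧-agree (t · u) eq = cong₂ _∙_
  (⟦⟧-agree t λ x ≢0 → eq x (≢0 ∘ m+n≡0⇒m≡0 _))
  (⟦⟧-agree u λ x ≢0 → eq x (≢0 ∘ m+n≡0⇒n≡0 (occurrences (index x) t)))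

⟦⟧-cong : (t : Γ ⊢ τ) {f g : Vals Γ} → (∀ {σ} (x : σ ∈ Γ) → f x ≡ g x) → ⟦ t ⟧ f ≡ ⟦ t ⟧ g
⟦⟧-cong t eq = ⟦⟧-agree t λ x _ → eq x

⟦⟧-rename : (r : Γ ⊆ Δ) (t : Γ ⊢ τ) (f : Vals Δ) → ⟦ rename r t ⟧ f ≡ ⟦ t ⟧ (λ x → f (r x))
⟦⟧-rename r (var x) f = refl
⟦⟧-rename r (ƛ t)   f = Λ-cong λ v → trans (⟦⟧-rename (∷⁺ʳ _ r) t (extend v f))
  (⟦⟧-cong t λ { (here refl) → refl ; (there x) → refl })
⟦⟧-rename r (t · u) f = cong₂ _∙_ (⟦⟧-rename r t f) (⟦⟧-rename r u f)

⟦⟧-subst : (s : Subst Γ Δ) (t : Γ ⊢ τ) (f : Vals Δ) → ⟦ Defs.subst s t ⟧ f ≡ ⟦ t ⟧ (λ x → ⟦ s x ⟧ f)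
⟦⟧-subst s (var x) f = refl
⟦⟧-subst s (ƛ t)   f = Λ-cong λ v → trans (⟦⟧-subst (lift s) t (extend v f))
  (⟦⟧-cong t λ { (here refl) → refl ; (there x) → ⟦⟧-rename there (s x) (extend v f) })
⟦⟧-subst s (t · u) f = cong₂ _∙_ (⟦⟧-subst s t f) (⟦⟧-subst s u f)

⟶-sound : {t u : Γ ⊢ τ} → t ⟶ u → (f : Vals Γ) → ⟦ t ⟧ f ≡ ⟦ u ⟧ f
⟶-sound (β {t = t} {u}) f = trans (Λ-β _ (⟦ u ⟧ f)) (sym (trans (⟦⟧-subst (Defs.single u) t f)
  (⟦⟧-cong t λ { (here refl) → refl ; (there x) → refl })))
⟶-sound (η {t = t}) f = ∙-ext λ v → trans (Λ-β _ v) (cong (_∙ v) (⟦⟧-rename there t (extend v f)))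
⟶-sound (Defs.ξ r)  f = Λ-cong λ v → ⟶-sound r (extend v f)
⟶-sound (·ˡ r) f = cong (_∙ _) (⟶-sound r f)
⟶-sound (·ʳ r) f = cong (_ ∙_) (⟶-sound r f)

=βη-sound : {t u : Γ ⊢ τ} → t =βη u → (f : Vals Γ) → ⟦ t ⟧ f ≡ ⟦ u ⟧ f
=βη-sound ε            f = refl
=βη-sound (fwd r ◅ rs) f = trans (⟶-sound r f) (=βη-sound rs f)
=βη-sound (bwd r ◅ rs) f = trans (sym (⟶-sound r f)) (=βη-sound rs f)

-- From occurrence counts to splittings

-- Omitted variables get the default 0: those of the environment, and those allotted to a sibling
-- subterm.
restrict : Sublist Δ Γ → Env Δ → Vals Γ
restrict (_ ∷ʳ p)   δ       (here refl) = constant 0F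
restrict (_ ∷ʳ p)   δ       (there x)   = restrict p δ x
restrict (refl ∷ p) (v ∷ δ) (here refl) = v
restrict (refl ∷ p) (v ∷ δ) (there x)   = restrict p δ x

Tm-restrict : (p : Sublist Δ Γ) (x : τ ∈ Γ) → Tm Δ τ (λ δ → restrict p δ x)
Tm-restrict (_ ∷ʳ p)   (here refl) = bot λ _ → refl
Tm-restrict (_ ∷ʳ p)   (there x)   = Tm-restrict p x
Tm-restrict (refl ∷ p) (here refl) = var (consˡ allʳ) λ { (v ∷ δ) → cong (v ∷_) (sym (Env-[] _)) }
Tm-restrict (refl ∷ p) (there x)   =
  Tm-weaken (consʳ allˡ) (Tm-restrict p x) λ { (v ∷ δ) → cong (λ y → restrict p y x) (sym (lft-allˡ δ)) }

-- `m` and `n` are the occurrence counts in function and argument. A kept variable goes left if `m`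
-- is positive there and right otherwise; affinity excludes that both are.
Sublist-split : (p : Sublist Δ Γ) (m n : Fin (length Γ) → ℕ) → (∀ i → m i + n i ≤ 1) →
  ∃[ Δ₁ ] ∃[ Δ₂ ] Σ[ s ∈ Split Δ₁ Δ₂ Δ ] Σ[ p₁ ∈ Sublist Δ₁ Γ ] Σ[ p₂ ∈ Sublist Δ₂ Γ ]
  (∀ δ {σ} (x : σ ∈ Γ) → m (index x) ≢ 0 → restrict p δ x ≡ restrict p₁ (lft s δ) x) ×
  (∀ δ {σ} (x : σ ∈ Γ) → n (index x) ≢ 0 → restrict p δ x ≡ restrict p₂ (rgt s δ) x)
Sublist-split [] m n ≤1 = -, -, [] , [] , [] , (λ _ ()) , λ _ ()
Sublist-split (_ ∷ʳ p) m n ≤1 =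
  let _ , _ , s , p₁ , p₂ , eq₁ , eq₂ = Sublist-split p (m ∘ suc) (n ∘ suc) (≤1 ∘ suc) in
  -, -, s , _ ∷ʳ p₁ , _ ∷ʳ p₂ ,
  (λ { δ (here refl) _ → refl ; δ (there x) → eq₁ δ x }) ,
  (λ { δ (here refl) _ → refl ; δ (there x) → eq₂ δ x })
Sublist-split (refl ∷ p) m n ≤1
  with Sublist-split p (m ∘ suc) (n ∘ suc) (≤1 ∘ suc) | m zero in m0 | n zero in n0 | ≤1 zero
... | _ , _ , s , p₁ , p₂ , eq₁ , eq₂ | zero  | _    | _ =
  -, -, consʳ s , _ ∷ʳ p₁ , refl ∷ p₂ ,
  (λ { (v ∷ δ) (here refl) ≢0 → ⊥-elim (≢0 m0) ; (v ∷ δ) (there x) → eq₁ δ x }) ,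
  (λ { (v ∷ δ) (here refl) _ → refl ; (v ∷ δ) (there x) → eq₂ δ x })
... | _ , _ , s , p₁ , p₂ , eq₁ , eq₂ | suc _ | zero | _ =
  -, -, consˡ s , refl ∷ p₁ , _ ∷ʳ p₂ ,
  (λ { (v ∷ δ) (here refl) _ → refl ; (v ∷ δ) (there x) → eq₁ δ x }) ,
  (λ { (v ∷ δ) (here refl) ≢0 → ⊥-elim (≢0 n0) ; (v ∷ δ) (there x) → eq₂ δ x })
... | _ | suc k | suc l | s≤s k+1+l≤0 with () ← subst (_≤ 0) (+-suc k l) k+1+l≤0

⊢⇒Tm : (t : Γ ⊢ τ) (p : Sublist Δ Γ) → Affine t → Tm Δ τ (λ δ → ⟦ t ⟧ (restrict p δ))
⊢⇒Tm (var x) p _ = Tm-restrict p x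
⊢⇒Tm (ƛ t)   p (≤1 , bound , A) =
  lam (⊢⇒Tm t (refl ∷ p) ((λ { zero → bound ; (suc i) → ≤1 i }) , A)) λ δ v →
    trans (Λ-β _ v) (⟦⟧-cong t λ { (here refl) → refl ; (there x) → refl })
⊢⇒Tm (t · u) p (≤1 , A , B) =
  let _ , _ , s , p₁ , p₂ , eq₁ , eq₂ =
        Sublist-split p (λ i → occurrences i t) (λ i → occurrences i u) ≤1 in
  app s (⊢⇒Tm t p₁ ((λ i → ≤-trans (m≤m+n _ _) (≤1 i)) , A))
        (⊢⇒Tm u p₂ ((λ i → ≤-trans (m≤n+m _ (occurrences i t)) (≤1 i)) , B))
    λ δ → cong₂ _∙_ (⟦⟧-agree t (eq₁ δ)) (⟦⟧-agree u (eq₂ δ))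

-- The coder keeps only `x` and the decoder no variable at all. With the environment at 0 on both
-- sides, variables shared by coder and decoder do no harm.
⊴¹⇒Retract : (Δ ⇛ atom b) ⊴¹ τ → Retract Δ b τ
⊴¹⇒Retract {Δ} {b} {τ} (R , affineC , affineD) = record
  { coder    = ⊢⇒Tm coder (refl ∷ minimum env) affineC
  ; decoder  = apply* {Θ = τ ∷ Δ} {h = λ θ → ⟦ decoder ⟧ (restrict (minimum env) []) ∙* θ}
                 (⊢⇒Tm decoder (minimum env) affineD) vars allʳ
                 λ θ → cong₂ (λ y z → ⟦ decoder ⟧ (restrict (minimum env) y) ∙* z)
                   (sym (Env-[] _)) (sym (rgt-allʳ θ))
  ; retracts = λ x ζ → let f = restrict (refl ∷ minimum env) (x ∷ []) in cong (_∙* ζ) (begin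
      ⟦ decoder ⟧ (λ y → f (there y)) ∙ ⟦ coder ⟧ f   ≡⟨ cong (_∙ ⟦ coder ⟧ f) (⟦⟧-rename there decoder f) ⟨
      ⟦ weaken decoder · coder ⟧ f                    ≡⟨ =βη-sound retract f ⟩
      x                                               ∎)
  }
  where
  open _⊴_ R
  open ≡-Reasoning

theorem3p5 : ∀ (ρ τ : Ty) → ρ ⊴¹ τ → CF⊢ ρ ⊴¹ τ
theorem3p5 ρ τ r with view ρ
... | Δ , b , refl = retract⇒CF (size τ) ≤-refl (⊴¹⇒Retract {Δ = Δ} {b = b} r)
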